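{- Let $n\ge 1$ and consider the single-peaked domain $\mathcal{SP}([n])$ with its associated Bruhat poset $\mathbb{B}(\mathcal{SP}([n]),1)$. The following (i) and (ii) are exactly the operations on sign representations that traverse the edges of the Bruhat poset: for $\sigma,\tau\in\mathcal{SP}([n])$ with sign representations $s(\sigma),s(\tau)\in\{+,-\}^{n-1}$, there is an edge between $\sigma$ and $\tau$ (i.e. one of them covers the other) in $\mathbb{B}(\mathcal{SP}([n]),1)$ if and only if $s(\tau)$ is obtained from $s(\sigma)$ by one application of one of the operations (i) change the first sign (from $+$ to $-$ or from $-$ to $+$); (ii) swap two opposite neighbouring signs, i.e. replace a pair of consecutive signs $+-$ by $-+$, or a pair of consecutive signs $-+$ by $+-$.
   Context: A preference (linear order) $\sigma$ on $[n]=\{1,\dots,n\}$ is written as a word $i_1 i_2\cdots i_n$, a permutation of $[n]$ listed from the most preferred alternative $i_1$ (the top, or peak) to the least preferred $i_n$. Write $a\succ b$ if $a$ is preferred to $b$, i.e. $a$ occurs before $b$ in the word. The preference with peak $k=i_1$ is single-peaked (with respect to the fixed axis $1<2<\cdots<n$) if for all $k_1,k_2\in[n]$, $k_2<k_1\le k$ or $k_2>k_1\ge k$ implies $k_1\succ k_2$. $\mathcal{SP}([n])$ denotes the set of all single-peaked preferences on $[n]$. Inversions and Bruhat poset: $\mathrm{Inv}(\sigma)$ is the set of pairs $(i,j)$ with $i,j\in[n]$, $i<j$, such that $j$ occurs before $i$ in the word $\sigma$ (so $\mathrm{Inv}(12\cdots n)=\emptyset$). Write $\sigma\ll\tau$ if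 $\mathrm{Inv}(\sigma)\subseteq\mathrm{Inv}(\tau)$. The Bruhat poset $\mathbb{B}(\mathcal{SP}([n]),1)$ is the poset $(\mathcal{SP}([n]),\ll)$. Its edges (arcs of the Bruhat digraph) are drawn from $\sigma$ to $\tau$ when $\tau$ covers $\sigma$, meaning that $\mathrm{Inv}(\sigma)\subset\mathrm{Inv}(\tau)$ and $\mathrm{Inv}(\tau)$ has exactly one more element than $\mathrm{Inv}(\sigma)$. Sign representation: in a single-peaked preference $\sigma=i_1\cdots i_n$ the first $p$ alternatives form an interval of consecutive integers for every $p$, and the next alternative is one of the two neighbours of that interval. For $1\le p\le n-1$ put $s_p=+$ if $i_{p+1}=\max\{i_1,\dots,i_p\}+1$ and $s_p=-$ if $i_{p+1}=\min\{i_1,\dots,i_p\}-1$. The sign representation of $\sigma$ is $s(\sigma)=(s_1,\dots,s_{n-1})$, and it uniquely specifies $\sigma$. For example, with $n=5$, $34251$ has sign representation $+-+-$. -}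

module Defs where

open import Data.Fin.Base
  using (Fin; Fin′; zero; suc; toℕ; fromℕ<; inject; inject₁; _<_; _≤_; _>_; _≥_)
open import Data.Fin.Properties
  using (_<?_; <-cmp; toℕ-inject; toℕ-inject₁; toℕ-injective; toℕ<n; toℕ-fromℕ<)
open import Data.Fin.Permutation using (Permutation′; _⟨$⟩ʳ_; _⟨$⟩ˡ_; inverseˡ; inverseʳ)
open import Data.List.Base as List using (List; length; filter; cartesianProduct; allFin)
open import Data.List.Extrema.Nat using (max; min; max≤v⁺; v≤max⁺; min≤v⁺; v≤min⁺)
open import Data.List.Relation.Unary.Any using (Any)
import Data.List.Relation.Unary.All.Properties as All
import Data.List.Relation.Unary.Any.Properties as Any
open import Data.Nat.Base as ℕ using (ℕ; suc; s≤s)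
import Data.Nat.Properties as ℕ
open import Data.Product.Base using (_×_; _,_)
open import Data.Sign.Base using (Sign; +; -; opposite)
open import Data.Sum.Base using (_⊎_; inj₁; inj₂; [_,_]′)
open import Data.Vec.Base using (Vec; _∷_; tabulate)
open import Function.Base using (const)
open import Level using (0ℓ)
open import Relation.Binary.Definitions using (tri<; tri≈; tri>)
open import Relation.Binary.PropositionalEquality
  using (_≡_; _≢_; refl; sym; trans; cong; subst; subst₂)
open import Relation.Nullary using (yes; no; contradiction)
open import Relation.Nullary.Decidable using (_×-dec_)
open import Relation.Unary using (Pred; Decidable; _⊂_)

private
  variable
    m n : ℕ

-- The word i₁ ⋯ iₙ, as the bijection from positions to alternatives.  Both are
-- numbered from 0, so the elements of Fin n stand for 1, …, n in order.
Preference : ℕ → Set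
Preference n = Permutation′ n

infix 4 _≻[_]_
_≻[_]_ : Fin n → Preference n → Fin n → Set
a ≻[ σ ] b = σ ⟨$⟩ˡ a < σ ⟨$⟩ˡ b

peak : Preference (suc m) → Fin (suc m)
peak σ = σ ⟨$⟩ʳ zero

SinglePeaked : Preference (suc m) → Set
SinglePeaked σ = ∀ k₁ k₂ →
  (k₂ < k₁ × k₁ ≤ peak σ) ⊎ (k₂ > k₁ × k₁ ≥ peak σ) → k₁ ≻[ σ ] k₂

-- SP m is the single-peaked domain on n = suc m alternatives.
record SP (m : ℕ) : Set where
  constructor _,_
  field
    word         : Preference (suc m)
    singlePeaked : SinglePeaked word

open SP public

Inv : Preference n → Pred (Fin n × Fin n) 0ℓ
Inv σ (i , j) = i < j × j ≻[ σ ] i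

Inv? : (σ : Preference n) → Decidable (Inv σ)
Inv? σ (i , j) = (i <? j) ×-dec (σ ⟨$⟩ˡ j <? σ ⟨$⟩ˡ i)

∣Inv_∣ : Preference n → ℕ
∣Inv_∣ {n} σ = length (filter (Inv? σ) (cartesianProduct (allFin n) (allFin n)))

infix 4 _⋖_
_⋖_ : SP m → SP m → Set
σ ⋖ τ = Inv (word σ) ⊂ Inv (word τ) × ∣Inv word τ ∣ ≡ suc ∣Inv word σ ∣

Edge : SP m → SP m → Set
Edge σ τ = σ ⋖ τ ⊎ τ ⋖ σ

-- For p : Fin m with toℕ p = q, the first q + 1 entries of the word are those
-- at the positions strictly before suc p, and the next entry is at suc p.
prefix : Preference (suc m) → Fin m → List ℕ
prefix σ p = List.tabulate λ (r : Fin′ (suc p)) → toℕ (σ ⟨$⟩ʳ inject r)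

next : Preference (suc m) → Fin m → ℕ
next σ p = toℕ (σ ⟨$⟩ʳ suc p)

-- The default value supplied to max and min is the peak, which is itself the
-- first entry of the prefix.
prefixMax prefixMin : Preference (suc m) → Fin m → ℕ
prefixMax σ p = max (toℕ (peak σ)) (prefix σ p)
prefixMin σ p = min (toℕ (peak σ)) (prefix σ p)

private
  module _ (σ : Preference (suc m)) (p : Fin m) where

    earlier⇒prefix : ∀ a → a ≻[ σ ] (σ ⟨$⟩ʳ suc p) →
                     ∀ {P : Pred ℕ 0ℓ} → P (toℕ a) → Any P (prefix σ p)
    earlier⇒prefix a a≻x {P} Pa = Any.tabulate⁺ {f = λ s → toℕ (σ ⟨$⟩ʳ inject {i = suc p} s)} r
      (subst (λ b → P (toℕ b)) (sym eq) Pa)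
      where
      q<p : σ ⟨$⟩ˡ a < suc p
      q<p = subst (σ ⟨$⟩ˡ a <_) (inverseˡ σ) a≻x
      r : Fin′ (suc p)
      r = fromℕ< q<p
      eq : σ ⟨$⟩ʳ inject r ≡ a
      eq = trans (cong (σ ⟨$⟩ʳ_)
             (toℕ-injective (trans (toℕ-inject r) (toℕ-fromℕ< q<p))))
             (inverseʳ σ)

    prefix-earlier : (r : Fin′ (suc p)) →
                     (σ ⟨$⟩ʳ inject r) ≻[ σ ] (σ ⟨$⟩ʳ suc p)
    prefix-earlier r = subst₂ _<_ (sym (inverseˡ σ)) (sym (inverseˡ σ))
      (subst (ℕ._< suc (toℕ p)) (sym (toℕ-inject r)) (toℕ<n r))

    earlier⇒≢ : ∀ {a b} → a ≻[ σ ] b → toℕ a ≢ toℕ b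
    earlier⇒≢ a≻b a≡b = ℕ.<⇒≢ a≻b (cong (λ c → toℕ (σ ⟨$⟩ˡ c)) (toℕ-injective a≡b))

next-adjacent : (σ : SP m) (p : Fin m) →
                next (word σ) p ≡ suc (prefixMax (word σ) p) ⊎
                suc (next (word σ) p) ≡ prefixMin (word σ) p
next-adjacent {m} (σ , sp) p with <-cmp (peak σ) x
  where x = σ ⟨$⟩ʳ suc p
... | tri≈ _ k≡x _ = contradiction
        (trans (sym (inverseˡ σ)) (trans (cong (σ ⟨$⟩ˡ_) k≡x) (inverseˡ σ))) λ ()
... | tri< k<x _ _ = inj₁ (above (σ ⟨$⟩ʳ suc p) refl k<x)
  where
  above : ∀ x → σ ⟨$⟩ʳ suc p ≡ x → peak σ < x → toℕ x ≡ suc (prefixMax σ p)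
  above (suc y) x≡ (s≤s k≤y) = cong suc (ℕ.≤-antisym
    (v≤max⁺ _ (prefix σ p) (inj₂ (earlier⇒prefix σ p (inject₁ y) y≻x y≤)))
    (max≤v⁺ k≤y (All.tabulate⁺ bound)))
    where
    y≤ : toℕ y ℕ.≤ toℕ (inject₁ y)
    y≤ = ℕ.≤-reflexive (sym (toℕ-inject₁ y))
    y≻x : inject₁ y ≻[ σ ] (σ ⟨$⟩ʳ suc p)
    y≻x = subst (inject₁ y ≻[ σ ]_) (sym x≡)
      (sp (inject₁ y) (suc y) (inj₂ (s≤s (ℕ.≤-reflexive (toℕ-inject₁ y)) , ℕ.≤-trans k≤y y≤)))
    bound : ∀ r → toℕ (σ ⟨$⟩ʳ inject r) ℕ.≤ toℕ y
    bound r with toℕ (σ ⟨$⟩ʳ inject r) ℕ.≤? toℕ y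
    ... | yes z≤y = z≤y
    ... | no  z≰y = contradiction
      (sp (suc y) (σ ⟨$⟩ʳ inject r)
        (inj₂ (ℕ.≤∧≢⇒< (ℕ.≰⇒> z≰y) (λ e → earlier⇒≢ σ p z≻x (sym e)) , ℕ.m≤n⇒m≤1+n k≤y)))
      (ℕ.<-asym z≻x)
      where
      z≻x : (σ ⟨$⟩ʳ inject r) ≻[ σ ] suc y
      z≻x = subst ((σ ⟨$⟩ʳ inject r) ≻[ σ ]_) x≡ (prefix-earlier σ p r)
... | tri> _ _ x<k = inj₂ (ℕ.≤-antisym
    (v≤min⁺ x<k (All.tabulate⁺ bound))
    (min≤v⁺ _ (prefix σ p) (inj₂ (earlier⇒prefix σ p y y≻x (ℕ.≤-reflexive y≡)))))
  where
  x : Fin (suc m)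
  x = σ ⟨$⟩ʳ suc p
  1+x<n : suc (toℕ x) ℕ.< suc m
  1+x<n = ℕ.≤-<-trans x<k (toℕ<n (peak σ))
  y : Fin (suc m)
  y = fromℕ< 1+x<n
  y≡ : toℕ y ≡ suc (toℕ x)
  y≡ = toℕ-fromℕ< 1+x<n
  y≻x : y ≻[ σ ] x
  y≻x = sp y x (inj₁ (ℕ.≤-reflexive (sym y≡) , ℕ.≤-trans (ℕ.≤-reflexive y≡) x<k))
  bound : ∀ r → suc (toℕ x) ℕ.≤ toℕ (σ ⟨$⟩ʳ inject r)
  bound r with suc (toℕ x) ℕ.≤? toℕ (σ ⟨$⟩ʳ inject r)
  ... | yes x<z = x<z
  ... | no  x≮z = contradiction
    (sp x (σ ⟨$⟩ʳ inject r)
      (inj₁ (ℕ.≤∧≢⇒< (ℕ.≮⇒≥ x≮z) (earlier⇒≢ σ p z≻x) , ℕ.<⇒≤ x<k)))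
    (ℕ.<-asym z≻x)
    where
    z≻x : (σ ⟨$⟩ʳ inject r) ≻[ σ ] x
    z≻x = prefix-earlier σ p r

signs : SP m → Vec Sign m
signs σ = tabulate λ p → [ const + , const - ]′ (next-adjacent σ p)

data ChangeFirst : Vec Sign m → Vec Sign m → Set where
  change : ∀ {s} {ss : Vec Sign m} → ChangeFirst (s ∷ ss) (opposite s ∷ ss)

data SwapNeighbours : Vec Sign m → Vec Sign m → Set where
  +-⇒-+ : {ss : Vec Sign m} → SwapNeighbours (+ ∷ - ∷ ss) (- ∷ + ∷ ss)
  -+⇒+- : {ss : Vec Sign m} → SwapNeighbours (- ∷ + ∷ ss) (+ ∷ - ∷ ss)
  later : ∀ {s} {ss ts : Vec Sign m} →
          SwapNeighbours ss ts → SwapNeighbours (s ∷ ss) (s ∷ ts)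

SignOperation : Vec Sign m → Vec Sign m → Set
SignOperation ss ts = ChangeFirst ss ts ⊎ SwapNeighbours ss ts

{-# OPTIONS --safe #-}

-- Let c k be the number of minuses among the signs with index at least k.  Since
-- every initial segment of the word is an interval, its first k + 1 entries are
-- exactly c k, …, c k + k.  It follows that (i , i + d + 1) is an inversion iff
-- i < c d, so inclusion of inversion sets is the pointwise order of the functions
-- c, and covering means that c grows by one at a single index d.  For d = 0 this
-- is a change of the first sign; for d = e + 1 the signs at e and e + 1 are swapped.

module Submission where

open import Defs
open import Data.Fin.Base as Fin using (Fin; zero; suc; toℕ; fromℕ<; inject; inject₁)
open import Data.Fin.Induction using (>-weakInduction)
open import Data.Fin.Permutation using (_⟨$⟩ʳ_; _⟨$⟩ˡ_; inverseˡ; inverseʳ)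
open import Data.Fin.Properties
  using (toℕ<n; toℕ-inject; toℕ-inject₁; toℕ-injective; toℕ-fromℕ; toℕ-fromℕ<; toℕ≤pred[n])
open import Data.List.Base using (List; []; _∷_; length; filter; allFin; cartesianProduct)
open import Data.List.Extrema.Nat using (v≤max⁺; min≤v⁺)
open import Data.List.Membership.Propositional using (_∈_)
open import Data.List.Membership.Propositional.Properties
  using (∈-filter⁺; ∈-filter⁻; ∈-allFin; ∈-cartesianProduct⁺)
open import Data.List.Relation.Unary.All using (_∷_)
open import Data.List.Relation.Unary.AllPairs using (_∷_)
open import Data.List.Relation.Unary.Any using (Any; here; there)
import Data.List.Relation.Unary.Any.Properties as Any
open import Data.List.Relation.Unary.Unique.Propositional using (Unique)
import Data.List.Relation.Unary.Unique.Propositional.Properties as Unique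
open import Data.Nat.Base using (ℕ; zero; suc; _+_; _≤_; _<_; z≤n; s≤s; s≤s⁻¹)
open import Data.Nat.Properties
open import Data.Product.Base using (∃₂; ∃-syntax; _×_; _,_; proj₁; proj₂)
open import Data.Sign.Base as Sign using (Sign)
open import Data.Sum.Base as Sum using (_⊎_; inj₁; inj₂)
open import Data.Vec.Base using (Vec; []; _∷_; lookup)
open import Data.Vec.Properties using (lookup∘tabulate)
open import Function.Base using (_∘_; const)
open import Function.Bundles using (_⇔_; mk⇔; Equivalence)
open import Relation.Binary.PropositionalEquality
  using (_≡_; _≢_; refl; sym; trans; cong; cong₂; subst; ≢-sym)
open import Relation.Nullary using (¬_; ¬?; yes; no; contradiction)
open import Relation.Nullary.Decidable using (_×-dec_)
open import Relation.Unary using (Pred; Decidable; _⊆_)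

open Equivalence using (to; from)

-- Counting with filtered lists.

module _ {a p q} {A : Set a} {P : Pred A p} {Q : Pred A q}
         (P? : Decidable P) (Q? : Decidable Q) where

  difference? : Decidable (λ x → Q x × ¬ P x)
  difference? x = Q? x ×-dec ¬? (P? x)

  -- For nested inversion sets this turns "exactly one inversion more" into "exactly one new
  -- inversion".
  length-filter-⊆ : P ⊆ Q → ∀ xs →
    length (filter Q? xs) ≡ length (filter difference? xs) + length (filter P? xs)
  length-filter-⊆ P⊆Q []       = refl
  length-filter-⊆ P⊆Q (x ∷ xs) with Q? x | P? x
  ... | yes _  | yes _  = trans (cong suc (length-filter-⊆ P⊆Q xs)) (sym (+-suc _ _))
  ... | yes _  | no _   = cong suc (length-filter-⊆ P⊆Q xs)
  ... | no ¬Qx | yes Px = contradiction (P⊆Q Px) ¬Qx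
  ... | no _   | no _   = length-filter-⊆ P⊆Q xs

module _ {a p} {A : Set a} {P : Pred A p} (P? : Decidable P) {xs : List A}
         (all : ∀ x → x ∈ xs) where

  length-filter≡1⇒∃! : length (filter P? xs) ≡ 1 → ∃[ x ] P x × (∀ {y} → P y → y ≡ x)
  length-filter≡1⇒∃! len
    -- The membership lemmas are abstracted together with the filtered list, so that they speak of
    -- `x ∷ []` after the match.
    with filter P? xs | (λ v → ∈-filter⁺ P? {v} {xs}) | (λ v → ∈-filter⁻ P? {v} {xs})
  ... | x ∷ [] | ∈⁺ | ∈⁻ = x , proj₂ (∈⁻ x (here refl)) , λ {y} Py → singleton (∈⁺ y (all y) Py)
    where
    singleton : ∀ {y} → y ∈ x ∷ [] → y ≡ x
    singleton (here y≡x) = y≡x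

  ∃!⇒length-filter≡1 : Unique xs → ∀ {x} → P x → (∀ {y} → P y → y ≡ x) →
                       length (filter P? xs) ≡ 1
  ∃!⇒length-filter≡1 unique Px P⇒≡x
    with filter P? xs | ∈-filter⁺ P? (all _) Px | (λ v → ∈-filter⁻ P? {v} {xs})
       | Unique.filter⁺ P? unique
  ... | _ ∷ []    | _ | _  | _ = refl
  ... | y ∷ z ∷ _ | _ | ∈⁻ | (y≢z ∷ _) ∷ _ = contradiction
    (trans (P⇒≡x (proj₂ (∈⁻ y (here refl)))) (sym (P⇒≡x (proj₂ (∈⁻ z (there (here refl))))))) y≢z

-- Counts of minus signs in final segments.

minus : Sign → ℕ
minus Sign.+ = 0
minus Sign.- = 1

minus-injective : ∀ {s t} → minus s ≡ minus t → s ≡ t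
minus-injective {Sign.+} {Sign.+} _ = refl
minus-injective {Sign.-} {Sign.-} _ = refl

minus≤1 : ∀ s → minus s ≤ 1
minus≤1 Sign.+ = z≤n
minus≤1 Sign.- = s≤s z≤n

minusesFrom : ∀ {m} → Vec Sign m → ℕ → ℕ
minusesFrom []       _       = 0
minusesFrom (s ∷ ss) zero    = minus s + minusesFrom ss zero
minusesFrom (s ∷ ss) (suc k) = minusesFrom ss k

minusesFrom-suc : ∀ {m} (ss : Vec Sign m) (p : Fin m) →
  minusesFrom ss (toℕ p) ≡ minus (lookup ss p) + minusesFrom ss (suc (toℕ p))
minusesFrom-suc (s ∷ ss) zero    = refl
minusesFrom-suc (s ∷ ss) (suc p) = minusesFrom-suc ss p

minusesFrom-end : ∀ {m} (ss : Vec Sign m) → minusesFrom ss m ≡ 0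
minusesFrom-end []       = refl
minusesFrom-end (_ ∷ ss) = minusesFrom-end ss

-- Only `m - k` signs have index at least `k`; the additive form avoids truncated subtraction.
minusesFrom-≤ : ∀ {m} (ss : Vec Sign m) {k} → k ≤ m → minusesFrom ss k + k ≤ m
minusesFrom-≤ []       {zero}  _         = z≤n
minusesFrom-≤ (s ∷ ss) {zero}  _
  rewrite +-assoc (minus s) (minusesFrom ss 0) 0 = +-mono-≤ (minus≤1 s) (minusesFrom-≤ ss z≤n)
minusesFrom-≤ (s ∷ ss) {suc k} (s≤s k≤m)
  rewrite +-suc (minusesFrom ss k) k = s≤s (minusesFrom-≤ ss k≤m)

<minusesFrom⇒≤ : ∀ {m} (ss : Vec Sign m) {i k} → i < minusesFrom ss k → k ≤ m
<minusesFrom⇒≤ (s ∷ ss) {k = zero}  _   = z≤n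
<minusesFrom⇒≤ (s ∷ ss) {k = suc k} i<c = s≤s (<minusesFrom⇒≤ ss i<c)

-- Ensures that the larger member `i + k + 1` of a prospective inversion is still an alternative.
<minusesFrom⇒+< : ∀ {m} (ss : Vec Sign m) {i k} → i < minusesFrom ss k → i + k < m
<minusesFrom⇒+< ss {k = k} i<c =
  ≤-trans (+-monoˡ-≤ k i<c) (minusesFrom-≤ ss (<minusesFrom⇒≤ ss i<c))

-- Each sign is the difference of two successive counts: once the tails agree, cancelling their
-- count at index 0 leaves the heads.
minusesFrom-injective : ∀ {m} {ss ts : Vec Sign m} →
  (∀ k → minusesFrom ss k ≡ minusesFrom ts k) → ss ≡ ts
minusesFrom-injective {ss = []}     {[]}     _  = refl
minusesFrom-injective {ss = s ∷ ss} {t ∷ ts} eq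
  with refl ← minusesFrom-injective {ss = ss} {ts} (eq ∘ suc)
  = cong (_∷ ss) (minus-injective (+-cancelʳ-≡ (minusesFrom ss 0) _ _ (eq 0)))

-- Raising one count and the sign operations.

record Raise {m} (d : ℕ) (ss ts : Vec Sign m) : Set where
  constructor _,_
  field
    -- This forces `d` below `m`, as all counts vanish from index `m` on; hence `d` can be a plain
    -- natural number.
    at   : minusesFrom ts d ≡ suc (minusesFrom ss d)
    away : ∀ {k} → k ≢ d → minusesFrom ts k ≡ minusesFrom ss k

Raise-tail : ∀ {m d s t} {ss ts : Vec Sign m} → Raise (suc d) (s ∷ ss) (t ∷ ts) → Raise d ss ts
Raise-tail (at , away) = at , λ k≢d → away (k≢d ∘ suc-injective)

-- The index has to be positive: a raise at 0 would also increase the total count of the longer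
-- vector, whereas here the total of the tails is unchanged.
Raise-∷ : ∀ {m d s} {ss ts : Vec Sign m} → Raise (suc d) ss ts → Raise (2 + d) (s ∷ ss) (s ∷ ts)
Raise-∷ {d = d} {s} {ss} {ts} (at , away) = at , λ {k} → away′ {k}
  where
  away′ : ∀ {k} → k ≢ 2 + d → minusesFrom (s ∷ ts) k ≡ minusesFrom (s ∷ ss) k
  away′ {zero}  _   = cong (minus s +_) (away λ ())
  away′ {suc k} k≢d = away (k≢d ∘ cong suc)

-- Matching on `raiseFirst` fixes both heads and identifies the tails at once; both kinds of
-- operation are read off from it.
data RaiseFirst {m} : Vec Sign (suc m) → Vec Sign (suc m) → Set where
  raiseFirst : ∀ {ss} → RaiseFirst (Sign.+ ∷ ss) (Sign.- ∷ ss)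

-- All counts at positive indices agree, so the tails coincide and the head alone supplies the extra
-- minus.
Raise-zero : ∀ {m} {ss ts : Vec Sign (suc m)} → Raise 0 ss ts → RaiseFirst ss ts
Raise-zero {ss = s ∷ ss} {t ∷ ts} (at , away)
  with refl ← minusesFrom-injective {ss = ts} {ss} (λ k → away {suc k} λ ())
  with s | t | +-cancelʳ-≡ (minusesFrom ss 0) (minus t) (suc (minus s)) at
... | Sign.+ | Sign.- | _ = raiseFirst
... | Sign.- | Sign.+ | ()
... | Sign.- | Sign.- | ()

Raise-zero⇒ChangeFirst : ∀ {m} {ss ts : Vec Sign m} → Raise 0 ss ts → ChangeFirst ss ts
Raise-zero⇒ChangeFirst {ss = []}    {[]} (() , _)
Raise-zero⇒ChangeFirst {ss = _ ∷ _} r with raiseFirst ← Raise-zero r = change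

-- A raise at 1 turns the second sign from + to -; since the total stays fixed, the first sign must
-- compensate by going from - to +. A raise further on leaves the first sign alone and recurses into
-- the tail.
Raise-suc⇒SwapNeighbours : ∀ {m d} {ss ts : Vec Sign m} →
                           Raise (suc d) ss ts → SwapNeighbours ss ts
Raise-suc⇒SwapNeighbours {ss = []} {[]} (() , _)
Raise-suc⇒SwapNeighbours {d = zero} {_ ∷ []} {_ ∷ []} (() , _)
Raise-suc⇒SwapNeighbours {d = zero} {s ∷ _ ∷ _} {t ∷ _ ∷ _} r
  with raiseFirst {us} ← Raise-zero (Raise-tail r)
  with s | t | +-cancelʳ-≡ (minusesFrom us 0) (minus t + 1) (minus s)
                 (trans (+-assoc (minus t) 1 _) (Raise.away r {0} λ ()))
... | Sign.- | Sign.+ | _  = -+⇒+-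
... | Sign.+ | Sign.+ | ()
... | Sign.+ | Sign.- | ()
... | Sign.- | Sign.- | ()
Raise-suc⇒SwapNeighbours {d = suc d} {s ∷ ss} {t ∷ ts} r
  -- The counts at 0 and at 1 are both unchanged, so the first signs are equal.
  with refl ← minus-injective {t} {s} (+-cancelʳ-≡ (minusesFrom ss 0) _ _
         (trans (cong (minus t +_) (sym (Raise.away (Raise-tail r) {0} λ ())))
                (Raise.away r {0} λ ())))
  = later (Raise-suc⇒SwapNeighbours (Raise-tail r))

ChangeFirst-sym : ∀ {m} {ss ts : Vec Sign m} → ChangeFirst ss ts → ChangeFirst ts ss
ChangeFirst-sym (change {s = Sign.+}) = change
ChangeFirst-sym (change {s = Sign.-}) = change

SwapNeighbours-sym : ∀ {m} {ss ts : Vec Sign m} → SwapNeighbours ss ts → SwapNeighbours ts ss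
SwapNeighbours-sym +-⇒-+     = -+⇒+-
SwapNeighbours-sym -+⇒+-     = +-⇒-+
SwapNeighbours-sym (later w) = later (SwapNeighbours-sym w)

SignOperation-sym : ∀ {m} {ss ts : Vec Sign m} → SignOperation ss ts → SignOperation ts ss
SignOperation-sym = Sum.map ChangeFirst-sym SwapNeighbours-sym

Raise⇒SignOperation : ∀ {m} {ss ts : Vec Sign m} → ∃[ d ] Raise d ss ts → SignOperation ss ts
Raise⇒SignOperation (zero  , r) = inj₁ (Raise-zero⇒ChangeFirst r)
Raise⇒SignOperation (suc _ , r) = inj₂ (Raise-suc⇒SwapNeighbours r)

Raise-head : ∀ {m} (ss : Vec Sign m) → Raise 0 (Sign.+ ∷ ss) (Sign.- ∷ ss)
Raise-head ss = refl , λ { {zero} k≢k → contradiction refl k≢k ; {suc _} _ → refl }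

ChangeFirst⇒Raise : ∀ {m} {ss ts : Vec Sign m} → ChangeFirst ss ts →
                    Raise 0 ss ts ⊎ Raise 0 ts ss
ChangeFirst⇒Raise (change {s = Sign.+} {ss = ss}) = inj₁ (Raise-head ss)
ChangeFirst⇒Raise (change {s = Sign.-} {ss = ss}) = inj₂ (Raise-head ss)

Raise-swap : ∀ {m} (ss : Vec Sign m) → Raise 1 (Sign.- ∷ Sign.+ ∷ ss) (Sign.+ ∷ Sign.- ∷ ss)
Raise-swap ss = refl , λ
  { {0} _ → refl ; {1} k≢k → contradiction refl k≢k ; {suc (suc _)} _ → refl }

SwapNeighbours⇒Raise : ∀ {m} {ss ts : Vec Sign m} → SwapNeighbours ss ts →
                       ∃[ d ] (Raise (suc d) ss ts ⊎ Raise (suc d) ts ss)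
SwapNeighbours⇒Raise (+-⇒-+ {ss = ss}) = 0 , inj₂ (Raise-swap ss)
SwapNeighbours⇒Raise (-+⇒+- {ss = ss}) = 0 , inj₁ (Raise-swap ss)
SwapNeighbours⇒Raise (later w) with SwapNeighbours⇒Raise w
... | d , r = suc d , Sum.map Raise-∷ Raise-∷ r

SignOperation⇒Raise : ∀ {m} {ss ts : Vec Sign m} → SignOperation ss ts →
                      ∃[ d ] (Raise d ss ts ⊎ Raise d ts ss)
SignOperation⇒Raise (inj₁ c) = 0 , ChangeFirst⇒Raise c
SignOperation⇒Raise (inj₂ w) with SwapNeighbours⇒Raise w
... | d , r = suc d , r

-- Positions of alternatives and the meaning of a sign.

position : ∀ {n} → Preference n → Fin n → ℕ
position σ x = toℕ (σ ⟨$⟩ˡ x)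

position-injective : ∀ {n} (σ : Preference n) {x y} → position σ x ≡ position σ y → x ≡ y
position-injective σ eq = trans (sym (inverseʳ σ))
  (trans (cong (σ ⟨$⟩ʳ_) (toℕ-injective eq)) (inverseʳ σ))

position-entry : ∀ {n} (σ : Preference n) p → position σ (σ ⟨$⟩ʳ p) ≡ toℕ p
position-entry σ p = cong toℕ (inverseˡ σ)

-- The predicate is arbitrary because the bounds for `max` and `min` take an `Any` of an inequality.
∈-prefix : ∀ {m} (σ : Preference (suc m)) (p : Fin m) {x} → position σ x ≤ toℕ p →
           ∀ {P : ℕ → Set} → P (toℕ x) → Any P (prefix σ p)
∈-prefix σ p {x} x≤p {P} Px =
  Any.tabulate⁺ {f = λ s → toℕ (σ ⟨$⟩ʳ inject {i = suc p} s)} (fromℕ< (s≤s x≤p))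
    (subst (P ∘ toℕ) (sym eq) Px)
  where
  eq : σ ⟨$⟩ʳ inject {i = suc p} (fromℕ< (s≤s x≤p)) ≡ x
  eq = position-injective σ (trans (position-entry σ _)
         (trans (toℕ-inject {i = suc p} (fromℕ< (s≤s x≤p))) (toℕ-fromℕ< (s≤s x≤p))))

-- The sign as an order relation between entries, free of the list extrema in `next-adjacent`.
SignOfEntry : ∀ {m} → Preference (suc m) → Fin m → Sign → Set
SignOfEntry σ p s =
  s ≡ Sign.+ × (∀ {x} → position σ x ≤ toℕ p → toℕ x < next σ p) ⊎
  s ≡ Sign.- × (∀ {x} → position σ x ≤ toℕ p → next σ p < toℕ x)

-- Being a record, it lets unification recover `ss` from the type of a witness.
record SignsOf {m} (σ : SP m) (ss : Vec Sign m) : Set where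
  field
    sign-at : ∀ p → SignOfEntry (word σ) p (lookup ss p)

open SignsOf

signs-SignsOf : ∀ {m} (σ : SP m) → SignsOf σ (signs σ)
sign-at (signs-SignsOf σ) p = subst (SignOfEntry (word σ) p)
  (sym (lookup∘tabulate (λ p → Sum.[ const Sign.+ , const Sign.- ]′ (next-adjacent σ p)) p))
  (signOf (next-adjacent σ p))
  where
  signOf : (adj : next (word σ) p ≡ suc (prefixMax (word σ) p) ⊎
                  suc (next (word σ) p) ≡ prefixMin (word σ) p) →
           SignOfEntry (word σ) p (Sum.[ const Sign.+ , const Sign.- ]′ adj)
  signOf (inj₁ next≡) = inj₁ (refl , λ x≤p → subst (_ <_) (sym next≡)
    (s≤s (v≤max⁺ _ (prefix (word σ) p) (inj₂ (∈-prefix (word σ) p x≤p ≤-refl)))))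
  signOf (inj₂ next≡) = inj₂ (refl , λ x≤p → subst (_≤ _) (sym next≡)
    (min≤v⁺ _ (prefix (word σ) p) (inj₂ (∈-prefix (word σ) p x≤p ≤-refl))))

-- Initial segments of the word as intervals.

module _ {m} (σ : SP m) {ss : Vec Sign m} (signsOf : SignsOf σ ss) where

  private
    pos : Fin (suc m) → ℕ
    pos = position (word σ)

    c : ℕ → ℕ
    c = minusesFrom ss

  InitialInterval : ℕ → Set
  InitialInterval k = ∀ x → pos x ≤ k ⇔ (c k ≤ toℕ x × toℕ x ≤ c k + k)

  -- Of the interval formed by the entries up to position p + 1, the entry at
  -- position p + 1 is the maximum if the p-th sign is +, the minimum if it is -.
  initialInterval-step : ∀ (p : Fin m) → InitialInterval (suc (toℕ p)) → InitialInterval (toℕ p)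
  initialInterval-step p int x = step (sign-at signsOf p)
    where
    k : ℕ
    k = toℕ p

    y : Fin (suc m)
    y = word σ ⟨$⟩ʳ suc p

    end≤m : c (suc k) + suc k ≤ m
    end≤m = minusesFrom-≤ ss (toℕ<n p)

    minusesFrom-sign : ∀ {s} → lookup ss p ≡ s → c k ≡ minus s + c (suc k)
    minusesFrom-sign sign≡ =
      trans (minusesFrom-suc ss p) (cong (λ s → minus s + c (suc k)) sign≡)

    in-interval : ∀ {z} → pos z ≤ k → c (suc k) ≤ toℕ z × toℕ z ≤ c (suc k) + suc k
    in-interval z≤k = to (int _) (m≤n⇒m≤1+n z≤k)

    y-in-interval : c (suc k) ≤ toℕ y × toℕ y ≤ c (suc k) + suc k
    y-in-interval = to (int y) (≤-reflexive (position-entry (word σ) (suc p)))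

    ≢y⇒≤k : ∀ {z} → c (suc k) ≤ toℕ z → toℕ z ≤ c (suc k) + suc k → toℕ z ≢ toℕ y →
            pos z ≤ k
    ≢y⇒≤k {z} l u z≢y = s≤s⁻¹ (≤∧≢⇒< (from (int z) (l , u)) λ eq →
      z≢y (cong toℕ (position-injective (word σ)
        (trans eq (sym (position-entry (word σ) (suc p)))))))

    step : SignOfEntry (word σ) p (lookup ss p) →
           pos x ≤ k ⇔ (c k ≤ toℕ x × toℕ x ≤ c k + k)
    step (inj₁ (sign≡ , <y)) = subst (λ l → pos x ≤ k ⇔ (l ≤ toℕ x × toℕ x ≤ l + k))
      (sym (minusesFrom-sign sign≡)) (mk⇔
      (λ x≤k → proj₁ (in-interval x≤k) ,
               s≤s⁻¹ (subst (toℕ x <_) (+-suc _ k) (<-≤-trans (<y x≤k) (proj₂ y-in-interval))))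
      (λ (l , u) → ≢y⇒≤k l (≤-trans u (+-monoʳ-≤ _ (n≤1+n k))) λ x≡y →
        y-top (subst (_≤ c (suc k) + k) x≡y u)))
      where
      -- The top of the interval up to position `p + 1`. Were `y` below `z`, then `z` would be an
      -- earlier entry, and the sign + puts every earlier entry below `y`. The case of - is dual,
      -- with the bottom of the interval.
      z : Fin (suc m)
      z = fromℕ< (s≤s end≤m)
      z≡ : toℕ z ≡ c (suc k) + suc k
      z≡ = toℕ-fromℕ< (s≤s end≤m)
      y-top : ¬ toℕ y ≤ c (suc k) + k
      y-top y≤ = <-asym y<z (<y (≢y⇒≤k (subst (c (suc k) ≤_) (sym z≡) (m≤m+n _ _))
                                       (≤-reflexive z≡) (≢-sym (<⇒≢ y<z))))
        where
        y<z : toℕ y < toℕ z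
        y<z = subst (toℕ y <_) (sym (trans z≡ (+-suc _ k))) (s≤s y≤)
    step (inj₂ (sign≡ , y<)) = subst (λ l → pos x ≤ k ⇔ (l ≤ toℕ x × toℕ x ≤ l + k))
      (sym (minusesFrom-sign sign≡)) (mk⇔
      (λ x≤k → ≤-<-trans (proj₁ y-in-interval) (y< x≤k) ,
               subst (toℕ x ≤_) (+-suc _ k) (proj₂ (in-interval x≤k)))
      (λ (l , u) → ≢y⇒≤k (<⇒≤ l) (subst (toℕ x ≤_) (sym (+-suc _ k)) u) λ x≡y →
        y-bottom (subst (c (suc k) <_) x≡y l)))
      where
      z<n : c (suc k) < suc m
      z<n = s≤s (m+n≤o⇒m≤o _ end≤m)
      z : Fin (suc m)
      z = fromℕ< z<n
      z≡ : toℕ z ≡ c (suc k)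
      z≡ = toℕ-fromℕ< z<n
      y-bottom : ¬ c (suc k) < toℕ y
      y-bottom c<y = <-asym z<y (y< (≢y⇒≤k (≤-reflexive (sym z≡))
        (subst (_≤ c (suc k) + suc k) (sym z≡) (m≤m+n _ _)) (<⇒≢ z<y)))
        where
        z<y : toℕ z < toℕ y
        z<y = subst (_< toℕ y) (sym z≡) c<y

  -- The induction runs downwards because the counts start from the end: for `k = m` the interval
  -- consists of all alternatives, and each step removes the last entry.
  initialInterval : ∀ {k} → k ≤ m → InitialInterval k
  initialInterval k≤m = subst InitialInterval (toℕ-fromℕ< (s≤s k≤m))
    (>-weakInduction (InitialInterval ∘ toℕ) end
      (λ p → subst InitialInterval (sym (toℕ-inject₁ p)) ∘ initialInterval-step p)
      (fromℕ< (s≤s k≤m)))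
    where
    end : InitialInterval (toℕ (Fin.fromℕ m))
    end = subst InitialInterval (sym (toℕ-fromℕ m)) λ x →
      subst (λ l → pos x ≤ m ⇔ (l ≤ toℕ x × toℕ x ≤ l + m)) (sym (minusesFrom-end ss))
        (mk⇔ (λ _ → z≤n , toℕ≤pred[n] x) (λ _ → toℕ≤pred[n] _))

  -- Inversions in terms of the counts.

  private
    pos-peak : pos (peak (word σ)) ≡ 0
    pos-peak = position-entry (word σ) zero

  peak-in-interval : ∀ {k} → k ≤ m → c k ≤ toℕ (peak (word σ)) × toℕ (peak (word σ)) ≤ c k + k
  peak-in-interval k≤m = to (initialInterval k≤m _) (subst (_≤ _) (sym pos-peak) z≤n)

  -- The left end of the segment ending at `i` is at most `i`. If it were smaller, it would lie
  -- farther from the peak on the same side, so single-peakedness would place it after `i`, outside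
  -- the segment.
  minusesFrom-position : ∀ {i} → toℕ i ≤ toℕ (peak (word σ)) → c (pos i) ≡ toℕ i
  minusesFrom-position {i} i≤peak = ≤-antisym c≤i (≮⇒≥ c≮i)
    where
    q≤m : pos i ≤ m
    q≤m = toℕ≤pred[n] _
    c≤i : c (pos i) ≤ toℕ i
    c≤i = proj₁ (to (initialInterval q≤m i) ≤-refl)
    c<n : c (pos i) < suc m
    c<n = ≤-<-trans c≤i (toℕ<n i)
    z : Fin (suc m)
    z = fromℕ< c<n
    z≡ : toℕ z ≡ c (pos i)
    z≡ = toℕ-fromℕ< c<n
    c≮i : ¬ c (pos i) < toℕ i
    c≮i c<i = <⇒≱ (singlePeaked σ i z (inj₁ (subst (_< toℕ i) (sym z≡) c<i , i≤peak)))
      (from (initialInterval q≤m z)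
        (≤-reflexive (sym z≡) , subst (_≤ c (pos i) + pos i) (sym z≡) (m≤m+n _ _)))

  -- Either side forces `i` to be at most the peak. With `q` the position of `i`, the first `q + 1`
  -- entries are then `i`, ..., `i + q`, so `j = i + d + 1` precedes `i` iff `d < q`. This says that
  -- `i` is not among the first `d + 1` entries, that is, `i < c d`.
  Inv⇔<minusesFrom : ∀ {i j} →
    Inv (word σ) (i , j) ⇔ (∃[ d ] toℕ j ≡ suc (toℕ i + d) × toℕ i < c d)
  Inv⇔<minusesFrom {i} {j} = mk⇔ fwd bwd
    where
    fwd : Inv (word σ) (i , j) → ∃[ d ] toℕ j ≡ suc (toℕ i + d) × toℕ i < c d
    fwd (i<j , j≻i) with m≤n⇒∃[o]m+o≡n i<j
    -- The upper bound `i ≤ c d + d` comes from the peak, which lies in every initial interval; so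
    -- `i` can miss the interval only on the left.
    ... | d , eq = d , sym eq , ≰⇒> λ c≤i →
        <⇒≱ d<q (from (initialInterval d≤m i) (c≤i , ≤-trans i≤peak (proj₂ (peak-in-interval d≤m))))
      where
      i≤peak : toℕ i ≤ toℕ (peak (word σ))
      i≤peak = ≮⇒≥ λ peak<i →
        <-asym j≻i (singlePeaked σ i j (inj₂ (i<j , <⇒≤ peak<i)))
      j≤ : toℕ j ≤ toℕ i + pos i
      j≤ = subst (λ z → toℕ j ≤ z + pos i) (minusesFrom-position i≤peak)
             (proj₂ (to (initialInterval (toℕ≤pred[n] _) j) (<⇒≤ j≻i)))
      d<q : d < pos i
      d<q = +-cancelˡ-< (toℕ i) _ _ (subst (_≤ toℕ i + pos i) (sym eq) j≤)
      d≤m : d ≤ m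
      d≤m = ≤-trans (<⇒≤ d<q) (toℕ≤pred[n] _)
    bwd : (∃[ d ] toℕ j ≡ suc (toℕ i + d) × toℕ i < c d) → Inv (word σ) (i , j)
    bwd (d , j≡ , i<c) = i<j , ≤∧≢⇒< j≤q (<⇒≢ i<j ∘ cong toℕ ∘ sym ∘ position-injective (word σ))
      where
      d≤m : d ≤ m
      d≤m = <minusesFrom⇒≤ ss i<c
      i<j : toℕ i < toℕ j
      i<j = subst (toℕ i <_) (sym j≡) (s≤s (m≤m+n _ d))
      c≡i : c (pos i) ≡ toℕ i
      c≡i = minusesFrom-position (<⇒≤ (<-≤-trans i<c (proj₁ (peak-in-interval d≤m))))
      d<q : d < pos i
      d<q = ≰⇒> λ q≤d → <⇒≱ i<c (proj₁ (to (initialInterval d≤m i) q≤d))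
      j≤q : pos j ≤ pos i
      j≤q = from (initialInterval (toℕ≤pred[n] _) j)
        ( subst (_≤ toℕ j) (sym c≡i) (<⇒≤ i<j)
        , subst (λ z → toℕ j ≤ z + pos i) (sym c≡i)
            (subst (_≤ toℕ i + pos i) (sym j≡) (+-monoʳ-< (toℕ i) d<q)))

  inversionAt : ∀ {i d} → i < c d →
    ∃₂ λ a b → Inv (word σ) (a , b) × toℕ a ≡ i × toℕ b ≡ suc (i + d)
  inversionAt {i} {d} i<c =
    fromℕ< i<n , fromℕ< j<n ,
    from Inv⇔<minusesFrom
      (d , trans b≡ (cong (λ z → suc (z + d)) (sym a≡)) , subst (_< c d) (sym a≡) i<c) ,
    a≡ , b≡
    where
    j<n : suc (i + d) < suc m
    j<n = s≤s (<minusesFrom⇒+< ss i<c)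
    i<n : i < suc m
    i<n = ≤-<-trans (m≤n⇒m≤1+n (m≤m+n i d)) j<n
    a≡ : toℕ (fromℕ< i<n) ≡ i
    a≡ = toℕ-fromℕ< i<n
    b≡ : toℕ (fromℕ< j<n) ≡ suc (i + d)
    b≡ = toℕ-fromℕ< j<n

  Inv⇒<minusesFrom : ∀ {i j d} → Inv (word σ) (i , j) → toℕ j ≡ suc (toℕ i + d) → toℕ i < c d
  Inv⇒<minusesFrom {i} {j} {d} inv j≡ with to Inv⇔<minusesFrom inv
  ... | e , j≡′ , i<c = subst (λ z → toℕ i < c z)
    (+-cancelˡ-≡ (toℕ i) e d (suc-injective (trans (sym j≡′) j≡))) i<c

-- Covering as raising one count.

module _ {m} (σ τ : SP m) {ss ts : Vec Sign m}
         (signsσ : SignsOf σ ss) (signsτ : SignsOf τ ts) where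

  private
    c c′ : ℕ → ℕ
    c  = minusesFrom ss
    c′ = minusesFrom ts

    New : Pred (Fin (suc m) × Fin (suc m)) _
    New x = Inv (word τ) x × ¬ Inv (word σ) x

    pairs : List (Fin (suc m) × Fin (suc m))
    pairs = cartesianProduct (allFin (suc m)) (allFin (suc m))

    all-pairs : ∀ x → x ∈ pairs
    all-pairs (i , j) = ∈-cartesianProduct⁺ (∈-allFin i) (∈-allFin j)

    unique-pairs : Unique pairs
    unique-pairs = Unique.cartesianProduct⁺ (Unique.allFin⁺ (suc m)) (Unique.allFin⁺ (suc m))

    new? : Decidable New
    new? = difference? (Inv? (word σ)) (Inv? (word τ))

    newAt : ∀ {i d} → c d ≤ i → i < c′ d →
            ∃₂ λ a b → New (a , b) × toℕ a ≡ i × toℕ b ≡ suc (i + d)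
    newAt {i} {d} c≤i i<c′ with inversionAt τ signsτ i<c′
    ... | a , b , inv , refl , b≡ =
      a , b , (inv , λ inv′ → <⇒≱ (Inv⇒<minusesFrom σ signsσ inv′ b≡) c≤i) , refl , b≡

  -- If `c′ k < c k`, the pair of `c′ k` and `c′ k + k + 1` is an inversion of `σ` but not of `τ`.
  Inv-⊆⇒minusesFrom-≤ : Inv (word σ) ⊆ Inv (word τ) → ∀ k → c k ≤ c′ k
  Inv-⊆⇒minusesFrom-≤ sub k = ≮⇒≥ λ c′<c → contra (inversionAt σ signsσ c′<c)
    where
    contra : ¬ (∃₂ λ a b → Inv (word σ) (a , b) × toℕ a ≡ c′ k × toℕ b ≡ suc (c′ k + k))
    contra (_ , _ , inv , a≡ , b≡) = <-irrefl a≡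
      (Inv⇒<minusesFrom τ signsτ (sub inv) (trans b≡ (cong (λ z → suc (z + k)) (sym a≡))))

  -- Every `a` with `c e ≤ a < c′ e` starts a new inversion of difference `e + 1`. As there is only
  -- one, the gaps between the counts have total size one.
  ∃!New⇒Raise : Inv (word σ) ⊆ Inv (word τ) → ∃[ x ] New x × (∀ {y} → New y → y ≡ x) →
                ∃[ d ] Raise d ss ts
  ∃!New⇒Raise sub ((i , j) , (inv , ¬inv) , unique) with to (Inv⇔<minusesFrom τ signsτ) inv
  ... | d , j≡ , i<c′ = d , at , away
    where
    c≤i : c d ≤ toℕ i
    c≤i = ≮⇒≥ λ i<c → ¬inv (from (Inv⇔<minusesFrom σ signsσ) (d , j≡ , i<c))

    new≡ : ∀ {a e} → c e ≤ a → a < c′ e → a ≡ toℕ i × e ≡ d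
    new≡ {a} {e} l u with newAt l u
    ... | _ , _ , new , refl , b≡ with refl ← unique new =
      refl , +-cancelˡ-≡ (toℕ i) e d (suc-injective (trans (sym b≡) j≡))

    at : c′ d ≡ suc (c d)
    at = ≤-antisym
      -- A gap of two or more at `d` would make both `c d` and `c d + 1` start new inversions.
      (≮⇒≥ λ 1+c<c′ → 1+n≢n (trans (proj₁ (new≡ (n≤1+n _) 1+c<c′))
                                   (sym (proj₁ (new≡ ≤-refl (<-trans (n<1+n _) 1+c<c′))))))
      (≤-<-trans c≤i i<c′)

    away : ∀ {k} → k ≢ d → c′ k ≡ c k
    away {k} k≢d = ≤-antisym (≮⇒≥ λ c<c′ → k≢d (proj₂ (new≡ ≤-refl c<c′)))
                             (Inv-⊆⇒minusesFrom-≤ sub k)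

  ⋖⇒Raise : σ ⋖ τ → ∃[ d ] Raise d ss ts
  ⋖⇒Raise ((sub , _) , len) = ∃!New⇒Raise sub
    (length-filter≡1⇒∃! new? all-pairs (+-cancelʳ-≡ ∣Inv word σ ∣ _ _
      (trans (sym (length-filter-⊆ (Inv? (word σ)) (Inv? (word τ)) sub pairs)) len)))

  Raise⇒⊆ : ∀ {d} → Raise d ss ts → Inv (word σ) ⊆ Inv (word τ)
  Raise⇒⊆ {d} (at , away) inv with to (Inv⇔<minusesFrom σ signsσ) inv
  ... | e , j≡ , i<c = from (Inv⇔<minusesFrom τ signsτ) (e , j≡ , <-≤-trans i<c (c≤c′ e))
    where
    c≤c′ : ∀ k → c k ≤ c′ k
    c≤c′ k with k ≟ d
    ... | yes refl = subst (c k ≤_) (sym at) (n≤1+n _)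
    ... | no  k≢d  = ≤-reflexive (sym (away k≢d))

  -- The gap at `d` contains only `c d`, and all other gaps are empty.
  Raise⇒∃!New : ∀ {d} → Raise d ss ts → ∃[ x ] New x × (∀ {y} → New y → y ≡ x)
  Raise⇒∃!New {d} (at , away) = new-pair (newAt {d = d} ≤-refl (≤-reflexive (sym at)))
    where
    new-pair : (∃₂ λ a b → New (a , b) × toℕ a ≡ c d × toℕ b ≡ suc (c d + d)) →
               ∃[ x ] New x × (∀ {y} → New y → y ≡ x)
    new-pair (a , b , new , a≡ , b≡) = (a , b) , new , unique
      where
      unique : ∀ {x} → New x → x ≡ (a , b)
      unique {i , j} (inv , ¬inv) with to (Inv⇔<minusesFrom τ signsτ) inv
      ... | e , j≡ , i<c′ with e ≟ d
      ...   | no e≢d   = contradiction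
        (from (Inv⇔<minusesFrom σ signsσ) (e , j≡ , subst (toℕ i <_) (away e≢d) i<c′)) ¬inv
      ...   | yes refl = cong₂ _,_ (toℕ-injective (trans i≡ (sym a≡)))
        (toℕ-injective (trans j≡ (trans (cong (λ z → suc (z + d)) i≡) (sym b≡))))
        where
        i≡ : toℕ i ≡ c d
        i≡ = ≤-antisym (s≤s⁻¹ (subst (toℕ i <_) at i<c′))
          (≮⇒≥ λ i<c → ¬inv (from (Inv⇔<minusesFrom σ signsσ) (d , j≡ , i<c)))

  ∃!New⇒⋖ : Inv (word σ) ⊆ Inv (word τ) → ∃[ x ] New x × (∀ {y} → New y → y ≡ x) → σ ⋖ τ
  ∃!New⇒⋖ sub (x , new@(inv , ¬inv) , unique) =
    (sub , λ sup → ¬inv (sup {x} inv)) ,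
    trans (length-filter-⊆ (Inv? (word σ)) (Inv? (word τ)) sub pairs)
      (cong (_+ ∣Inv word σ ∣) (∃!⇒length-filter≡1 new? all-pairs unique-pairs new unique))

  Raise⇒⋖ : ∀ {d} → Raise d ss ts → σ ⋖ τ
  Raise⇒⋖ r = ∃!New⇒⋖ (Raise⇒⊆ r) (Raise⇒∃!New r)

theorem3 : ∀ (m : ℕ) (σ τ : SP m) → Edge σ τ ⇔ SignOperation (signs σ) (signs τ)
theorem3 m σ τ = mk⇔ edge⇒ ⇒edge
  where
  signsσ : SignsOf σ (signs σ)
  signsσ = signs-SignsOf σ

  signsτ : SignsOf τ (signs τ)
  signsτ = signs-SignsOf τ

  edge⇒ : Edge σ τ → SignOperation (signs σ) (signs τ)
  edge⇒ (inj₁ σ⋖τ) = Raise⇒SignOperation (⋖⇒Raise σ τ signsσ signsτ σ⋖τ)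
  -- An edge has no direction here, and the sign operations are reversible.
  edge⇒ (inj₂ τ⋖σ) = SignOperation-sym (Raise⇒SignOperation (⋖⇒Raise τ σ signsτ signsσ τ⋖σ))

  ⇒edge : SignOperation (signs σ) (signs τ) → Edge σ τ
  ⇒edge op = Sum.map (Raise⇒⋖ σ τ signsσ signsτ) (Raise⇒⋖ τ σ signsτ signsσ)
    (proj₂ (SignOperation⇒Raise op))
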